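{- Let $n\ge2$ and $B_n=\langle a,b\mid ba=b^n\rangle$. 1. If $\mathsf d$ denotes the Levenshtein distance, then $\mathsf c_{\mathsf d}(B_n)=n-1$; and $B_n$ is half-factorial if and only if $n=2$. 2. For all $k,m\in\mathbb N_0$, \[\mathsf L(a^kb^m)=k+m-q_{m,n}(n-2)+(n-2)\cdot[0,q_{m,n}],\] where $q_{m,n}=\lfloor m/(n-1)\rfloor$ if $(n-1)\nmid m$; $q_{m,n}=\frac{m}{n-1}-1$ if $(n-1)\mid m$ and $m\neq0$; and $q_{m,n}=0$ if $m=0$.
   Context: $B_n$ is the monoid with generators $a,b$ and single relation $ba=b^n$; it is reduced and atomic with atoms $a,b$, and every element is uniquely $a^kb^m$ ($k,m\in\mathbb N_0$). Factorizations are words in the free monoid $\mathcal F^*(\{a,b\})$; $\pi$ maps a word to the element it represents; $\sim=\{(x,y)\mid\pi(x)=\pi(y)\}$. $\mathsf L(x)=\{|z|:\pi(z)=x\}$ (with $\mathsf L(1)=\{0\}$). The Levenshtein distance between words $z,z'$ is the minimal number of substitutions, deletions or insertions of single letters needed to transform $z$ into $z'$. For $x\in B_n$, the catenary degree $\mathsf c_{\mathsf d}(x)$ is the least $N\in\mathbb N_0\cup\{\infty\}$ such that any two factorizations $z,z'$ of $x$ are connected by a chain $z=z_0,\dots,z_r=z'$ of factorizations of $x$ with $\mathsf d(z_{i-1},z_i)\le N$; $\mathsf c_{\mathsf d}(B_n)=\sup_x\mathsf c_{\mathsf d}(x)$. Half-factorial: $|\mathsf L(x)|=1$ for all $x$.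 Notation: $[u,v]=\{z\in\mathbb Z:u\le z\le v\}$, $d\cdot L=\{dl:l\in L\}$, $m+L=\{m+l:l\in L\}$. -}

module Defs where

open import Algebra.Bundles using (Monoid)
import Algebra.Definitions.RawMonoid as RawMonoidDefs
open import Data.Empty using (⊥-elim)
open import Data.Integer as ℤ using (ℤ)
open import Data.List using (List; []; _∷_; [_]; _++_; map; foldr; length; replicate)
open import Data.List.Membership.Propositional using (_∈_; lose; find)
open import Data.List.Membership.Propositional.Properties using (∈-map⁺; ∈-map⁻)
open import Data.List.Properties using (++-assoc; ++-identityʳ; ≡-dec)
open import Data.List.Relation.Unary.Any using (here; there; any?)
open import Data.Nat using (ℕ; zero; suc; _∸_; _/_; _≤_; z≤n; s≤s; >-nonZero)
open import Data.Nat.Divisibility using (_∣?_)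
open import Data.Nat.Properties using (m<n⇒0<n∸m)
open import Data.Product using (_×_; _,_; ∃; ∃!; proj₁; proj₂)
open import Level using (0ℓ)
open import Relation.Binary.Construct.Closure.ReflexiveTransitive using (Star)
open import Relation.Binary.Core using (Rel)
open import Relation.Binary.PropositionalEquality using (_≡_; refl)
open import Relation.Nullary using (Dec; yes; no)
open import Relation.Nullary.Construct.Add.Supremum as Sup using (_⁺)
open import Relation.Nullary.Decidable using (map′)
open import Relation.Unary using (Pred)

open import Relation.Binary.Construct.Add.Supremum.NonStrict _≤_ using () renaming (_≤⁺_ to _≤∞_) public

ℕ∞ : Set
ℕ∞ = ℕ ⁺

fin : ℕ → ℕ∞
fin n = Sup.[ n ]

IsLeast : {A : Set} → Rel A 0ℓ → Pred A 0ℓ → Pred A 0ℓ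
IsLeast _⊑_ P m = P m × (∀ k → P k → m ⊑ k)

IsSupremum : {A I : Set} → Rel A 0ℓ → (I → A) → Pred A 0ℓ
IsSupremum _⊑_ f = IsLeast _⊑_ (λ u → ∀ i → f i ⊑ u)

data Letter : Set where
  a b : Letter

Word : Set
Word = List Letter

infix 4 _∼⟨_⟩_

-- The least monoid congruence on words containing (ba , bⁿ).
data _∼⟨_⟩_ : Word → ℕ → Word → Set where
  ba∼bⁿ  : ∀ {n} → b ∷ a ∷ [] ∼⟨ n ⟩ replicate n b
  ∼-refl  : ∀ {n u} → u ∼⟨ n ⟩ u
  ∼-sym   : ∀ {n u v} → u ∼⟨ n ⟩ v → v ∼⟨ n ⟩ u
  ∼-trans : ∀ {n u v w} → u ∼⟨ n ⟩ v → v ∼⟨ n ⟩ w → u ∼⟨ n ⟩ w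
  ∼-cong  : ∀ {n u u′ v v′} → u ∼⟨ n ⟩ u′ → v ∼⟨ n ⟩ v′ → u ++ v ∼⟨ n ⟩ u′ ++ v′

-- The quotient of the free monoid by this congruence, as a setoid.
B : ℕ → Monoid 0ℓ 0ℓ
B n = record
  { Carrier  = Word
  ; _≈_      = _∼⟨ n ⟩_
  ; _∙_      = _++_
  ; ε        = []
  ; isMonoid = record
    { isSemigroup = record
      { isMagma = record
        { isEquivalence = record { refl = ∼-refl ; sym = ∼-sym ; trans = ∼-trans }
        ; ∙-cong        = ∼-cong
        }
      ; assoc = λ x y z → ≡⇒∼ (++-assoc x y z)
      }
    ; identity = (λ _ → ∼-refl) , (λ x → ≡⇒∼ (++-identityʳ x))
    }
  }
  where
  ≡⇒∼ : ∀ {u v} → u ≡ v → u ∼⟨ n ⟩ v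
  ≡⇒∼ refl = ∼-refl

data Edit : Word → Word → Set where
  substitution : ∀ u x y v → Edit (u ++ x ∷ v) (u ++ y ∷ v)
  deletion     : ∀ u x v → Edit (u ++ x ∷ v) (u ++ v)
  insertion    : ∀ u x v → Edit (u ++ v) (u ++ x ∷ v)

data Edits : ℕ → Word → Word → Set where
  []  : ∀ {z} → Edits 0 z z
  _∷_ : ∀ {k z w z′} → Edit z w → Edits k w z′ → Edits (suc k) z z′

Edit-cons : ∀ x {z w} → Edit z w → Edit (x ∷ z) (x ∷ w)
Edit-cons x (substitution u y y′ v) = substitution (x ∷ u) y y′ v
Edit-cons x (deletion u y v)        = deletion (x ∷ u) y v
Edit-cons x (insertion u y v)       = insertion (x ∷ u) y v

Edits-cons : ∀ x {k z w} → Edits k z w → Edits k (x ∷ z) (x ∷ w)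
Edits-cons x []       = []
Edits-cons x (e ∷ es) = Edit-cons x e ∷ Edits-cons x es

Edits-exist : ∀ z z′ → ∃ λ k → Edits k z z′
Edits-exist []      []       = 0 , []
Edits-exist []      (y ∷ z′) with Edits-exist [] z′
... | k , es = suc k , insertion [] y [] ∷ Edits-cons y es
Edits-exist (x ∷ z) z′       with Edits-exist z z′
... | k , es = suc k , deletion [] x z ∷ es

_≟ᴸ_ : (x y : Letter) → Dec (x ≡ y)
a ≟ᴸ a = yes refl
a ≟ᴸ b = no λ ()
b ≟ᴸ a = no λ ()
b ≟ᴸ b = yes refl

neighbours : Word → List Word
neighbours []      = [ a ] ∷ [ b ] ∷ []
neighbours (x ∷ v) =
  v ∷ (a ∷ v) ∷ (b ∷ v) ∷ (a ∷ x ∷ v) ∷ (b ∷ x ∷ v) ∷ map (x ∷_) (neighbours v)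

neighbours-sound : ∀ z {w} → w ∈ neighbours z → Edit z w
neighbours-sound []      (here refl)                             = insertion [] a []
neighbours-sound []      (there (here refl))                     = insertion [] b []
neighbours-sound (x ∷ v) (here refl)                             = deletion [] x v
neighbours-sound (x ∷ v) (there (here refl))                     = substitution [] x a v
neighbours-sound (x ∷ v) (there (there (here refl)))             = substitution [] x b v
neighbours-sound (x ∷ v) (there (there (there (here refl))))     = insertion [] a (x ∷ v)
neighbours-sound (x ∷ v) (there (there (there (there (here refl))))) = insertion [] b (x ∷ v)
neighbours-sound (x ∷ v) (there (there (there (there (there p))))) with ∈-map⁻ (x ∷_) p
... | _ , q , refl = Edit-cons x (neighbours-sound v q)

neighbours-cons : ∀ x {v w} → w ∈ neighbours v → (x ∷ w) ∈ neighbours (x ∷ v)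
neighbours-cons x p = there (there (there (there (there (∈-map⁺ (x ∷_) p)))))

neighbours-complete : ∀ {z w} → Edit z w → w ∈ neighbours z
neighbours-complete (substitution [] x a v)      = there (here refl)
neighbours-complete (substitution [] x b v)      = there (there (here refl))
neighbours-complete (substitution (c ∷ u) x y v) = neighbours-cons c (neighbours-complete (substitution u x y v))
neighbours-complete (deletion [] x v)            = here refl
neighbours-complete (deletion (c ∷ u) x v)       = neighbours-cons c (neighbours-complete (deletion u x v))
neighbours-complete (insertion [] a [])          = here refl
neighbours-complete (insertion [] b [])          = there (here refl)
neighbours-complete (insertion [] a (y ∷ v))     = there (there (there (here refl)))
neighbours-complete (insertion [] b (y ∷ v))     = there (there (there (there (here refl))))
neighbours-complete (insertion (c ∷ u) x v)      = neighbours-cons c (neighbours-complete (insertion u x v))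

Edits? : ∀ z z′ k → Dec (Edits k z z′)
Edits? z z′ zero    = map′ (λ { refl → [] }) (λ { [] → refl }) (≡-dec _≟ᴸ_ z z′)
Edits? z z′ (suc k) = map′
  (λ p → let (_ , w∈ , es) = find p in neighbours-sound z w∈ ∷ es)
  (λ { (e ∷ es) → lose (neighbours-complete e) es })
  (any? (λ w → Edits? w z′ k) (neighbours z))

least : {P : Pred ℕ 0ℓ} → (∀ k → Dec (P k)) → ∀ k → P k → ∃ (IsLeast _≤_ P)
least P? zero    p = 0 , p , λ _ _ → z≤n
least {P} P? (suc k) p with P? 0
... | yes p₀ = 0 , p₀ , λ _ _ → z≤n
... | no ¬p₀ with least (λ i → P? (suc i)) k p
...   | m , pm , m-min = suc m , pm , minimal
  where
  minimal : ∀ i → P i → suc m ≤ i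
  minimal zero    p₀ = ⊥-elim (¬p₀ p₀)
  minimal (suc i) pᵢ = s≤s (m-min i pᵢ)

minimalEdits : ∀ z z′ → ∃ (IsLeast _≤_ (λ k → Edits k z z′))
minimalEdits z z′ = let (k , es) = Edits-exist z z′ in least (Edits? z z′) k es

levenshtein : Word → Word → ℕ
levenshtein z z′ = proj₁ (minimalEdits z z′)

module _ (n : ℕ) where

  open Monoid (B n) using (Carrier; _≈_; _∙_; ε; rawMonoid)

  gen : Letter → Carrier
  gen x = [ x ]

  π : Word → Carrier
  π z = foldr _∙_ ε (map gen z)

  normalForm : ℕ → ℕ → Carrier
  normalForm k m = (k · gen a) ∙ (m · gen b)
    where open RawMonoidDefs rawMonoid using () renaming (_×_ to _·_)

  IsFactorization : Carrier → Pred Word 0ℓ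
  IsFactorization x z = π z ≈ x

  L : Carrier → Pred ℕ 0ℓ
  L x l = ∃ λ z → IsFactorization x z × length z ≡ l

  HalfFactorial : Set
  HalfFactorial = ∀ x → ∃! _≡_ (L x)

  module _ (d : Word → Word → ℕ) where

    Link : Carrier → ℕ∞ → Rel Word 0ℓ
    Link x N z z′ = IsFactorization x z × IsFactorization x z′ × fin (d z z′) ≤∞ N

    ChainConnected : Carrier → Pred ℕ∞ 0ℓ
    ChainConnected x N =
      ∀ z z′ → IsFactorization x z → IsFactorization x z′ → Star (Link x N) z z′

    IsCatenaryDegreeAt : Carrier → Pred ℕ∞ 0ℓ
    IsCatenaryDegreeAt x = IsLeast _≤∞_ (ChainConnected x)

    -- c is determined by leastness; asking for it as a function makes the
    -- existence of every c(x) part of the claim, so that the supremum is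
    -- never taken over a partial family.
    IsCatenaryDegree : Pred ℕ∞ 0ℓ
    IsCatenaryDegree N =
      ∃ λ (c : Carrier → ℕ∞) → (∀ x → IsCatenaryDegreeAt x (c x)) × IsSupremum _≤∞_ c N

infixr 6 _+ˢ_
infixr 7 _·ˢ_

[_⋯_] : ℤ → ℤ → Pred ℤ 0ℓ
[ u ⋯ v ] z = u ℤ.≤ z × z ℤ.≤ v

_+ˢ_ : ℤ → Pred ℤ 0ℓ → Pred ℤ 0ℓ
(m +ˢ S) z = ∃ λ l → S l × z ≡ m ℤ.+ l

_·ˢ_ : ℤ → Pred ℤ 0ℓ → Pred ℤ 0ℓ
(d ·ˢ S) z = ∃ λ l → S l × z ≡ d ℤ.* l

asℤ : Pred ℕ 0ℓ → Pred ℤ 0ℓ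
asℤ S z = ∃ λ l → S l × z ≡ ℤ.+ l

-- In the divisible case m ≠ 0, so the quotient is positive and ∸ 1 does not truncate.
q : (m n : ℕ) → .(2 ≤ n) → ℕ
q zero      n 2≤n = 0
q m@(suc _) n 2≤n with (n ∸ 1) ∣? m
... | yes _ = (m / (n ∸ 1)) {{>-nonZero (m<n⇒0<n∸m 2≤n)}} ∸ 1
... | no  _ = (m / (n ∸ 1)) {{>-nonZero (m<n⇒0<n∸m 2≤n)}}

{-# OPTIONS --safe #-}
-- Put p = n − 1.  A letter b absorbs a letter a to its right and turns into bⁿ, so rewriting ba
-- to bⁿ reaches the word aᵏbᵐ.  In a word representing aᵏbᵐ call an a late if it occurs after some
-- b.  Exactly k letters are early a's, and each late a accounts for p of the m letters b: with β
-- letters b and α late a's, m = β + αp.  So the length is k + m − α(p − 1), and α ranges over the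
-- numbers with α = 0 or αp < m, that is, over 0, …, q.  A rewriting step costs p edits.  Conversely
-- β is determined modulo p, so a chain of factorizations with links of fewer than p edits changes
-- neither β nor α; since α = 0 and α = 1 both occur when m > p, no bound below p suffices then.
module Submission where

open import Defs
open import Data.Bool using (true; false)
open import Data.List using ([]; _∷_; _++_; filter; foldr; length; replicate)
open import Data.List.Properties
  using (concat-map-[_]; filter-++; foldr-++; length-++; length-replicate)
open import Data.Nat as ℕ using (ℕ; zero; suc; pred; NonZero; ∣_-_∣; _≤_; _<_; _∸_; z≤n; s≤s)
open import Data.Nat.DivMod using (m/n*n≡m; m/n*n≤m; m*n/n≡m; /-monoˡ-≤)
open import Data.Nat.Divisibility using (_∣?_; divides)
open import Data.Nat.Properties
open import Data.Nat.Tactic.RingSolver using (solve-∀)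
open import Data.Product using (_×_; _,_; ∃; proj₁; proj₂; map₁; map₂; uncurry)
open import Data.Sum using (_⊎_; inj₁; inj₂)
open import Function.Base using (_∘_)
open import Function.Bundles using (_⇔_; mk⇔)
open import Level using (0ℓ)
open import Relation.Binary.Construct.Add.Supremum.NonStrict _≤_
  using ([_]; _≤⊤⁺; ≤⁺-trans; [≤]-injective)
open import Relation.Binary.Construct.Closure.ReflexiveTransitive
  using (Star; ε; _◅_; _◅◅_; fold; gmap; reverse)
open import Relation.Binary.Definitions using (Symmetric)
open import Relation.Binary.PropositionalEquality
  using (_≡_; refl; sym; trans; cong; cong₂; subst; module ≡-Reasoning)
open import Relation.Nullary using (does; yes; no)
open import Relation.Nullary.Construct.Add.Supremum using (⊤⁺) renaming ([_] to [_]⁺)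
open import Relation.Unary using (Pred; _≐_)

∣m+o-n+o∣≡∣m-n∣ : ∀ m n o → ∣ m ℕ.+ o - n ℕ.+ o ∣ ≡ ∣ m - n ∣
∣m+o-n+o∣≡∣m-n∣ m n o = trans (cong₂ ∣_-_∣ (+-comm m o) (+-comm n o)) (∣m+n-m+o∣≡∣n-o∣ o m n)

m+n≡o+i⇒∣m-o∣≡∣n-i∣ : ∀ m {n} o {i} → m ℕ.+ n ≡ o ℕ.+ i → ∣ m - o ∣ ≡ ∣ n - i ∣
m+n≡o+i⇒∣m-o∣≡∣n-i∣ m {n} o {i} m+n≡o+i = begin
  ∣ m - o ∣                ≡⟨ ∣m+o-n+o∣≡∣m-n∣ m o n ⟨
  ∣ m ℕ.+ n - o ℕ.+ n ∣    ≡⟨ cong (λ j → ∣ j - o ℕ.+ n ∣) m+n≡o+i ⟩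
  ∣ o ℕ.+ i - o ℕ.+ n ∣    ≡⟨ ∣m+n-m+o∣≡∣n-o∣ o i n ⟩
  ∣ i - n ∣                ≡⟨ ∣-∣-comm i n ⟩
  ∣ n - i ∣                ∎
  where open ≡-Reasoning

m*n<n⇒m≡0 : ∀ m n → m ℕ.* n < n → m ≡ 0
m*n<n⇒m≡0 m n m*n<n = n<1⇒n≡0 (*-cancelʳ-< n m 1 (subst (m ℕ.* n <_) (sym (*-identityˡ n)) m*n<n))

-- The Levenshtein distance

Edit-sym : Symmetric Edit
Edit-sym (substitution u x y v) = substitution u y x v
Edit-sym (deletion u x v)       = insertion u x v
Edit-sym (insertion u x v)      = deletion u x v

Edits-snoc : ∀ {k z w z′} → Edits k z w → Edit w z′ → Edits (suc k) z z′
Edits-snoc []       e = e ∷ []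
Edits-snoc (f ∷ es) e = f ∷ Edits-snoc es e

Edits-sym : ∀ {k} → Symmetric (Edits k)
Edits-sym []       = []
Edits-sym (e ∷ es) = Edits-snoc (Edits-sym es) (Edit-sym e)

Edits-++ˡ : ∀ u {k z w} → Edits k z w → Edits k (u ++ z) (u ++ w)
Edits-++ˡ []      es = es
Edits-++ˡ (x ∷ u) es = Edits-cons x (Edits-++ˡ u es)

Edits-prepend-replicate : ∀ k x v → Edits k v (replicate k x ++ v)
Edits-prepend-replicate zero    x v = []
Edits-prepend-replicate (suc k) x v =
  insertion [] x v ∷ Edits-cons x (Edits-prepend-replicate k x v)

Edits-letter-to-power : ∀ k .{{_ : NonZero k}} x y v → Edits k (x ∷ v) (replicate k y ++ v)
Edits-letter-to-power (suc k) x y v =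
  substitution [] x y v ∷ Edits-cons y (Edits-prepend-replicate k y v)

levenshtein-edits : ∀ z w → Edits (levenshtein z w) z w
levenshtein-edits z w = proj₁ (proj₂ (minimalEdits z w))

levenshtein-≤ : ∀ {k z w} → Edits k z w → levenshtein z w ≤ k
levenshtein-≤ {k} {z} {w} = proj₂ (proj₂ (minimalEdits z w)) k

levenshtein-sym : ∀ z w → levenshtein z w ≡ levenshtein w z
levenshtein-sym z w = ≤-antisym
  (levenshtein-≤ (Edits-sym (levenshtein-edits w z)))
  (levenshtein-≤ (Edits-sym (levenshtein-edits z w)))

Link-sym : ∀ {n x N} z w → Link n levenshtein x N z w → Link n levenshtein x N w z
Link-sym {N = N} z w (fz , fw , d≤N) = fw , fz , subst (λ d → fin d ≤∞ N) (levenshtein-sym z w) d≤N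

# : Letter → Word → ℕ
# x = length ∘ filter (x ≟ᴸ_)

#-++ : ∀ x u v → # x (u ++ v) ≡ # x u ℕ.+ # x v
#-++ x u v = trans (cong length (filter-++ (x ≟ᴸ_) u v)) (length-++ (filter (x ≟ᴸ_) u))

#-letter≤1 : ∀ x y → # x (y ∷ []) ≤ 1
#-letter≤1 x y with does (x ≟ᴸ y)
... | true  = s≤s z≤n
... | false = z≤n

length≡#a+#b : ∀ w → length w ≡ # a w ℕ.+ # b w
length≡#a+#b []      = refl
length≡#a+#b (a ∷ w) = cong suc (length≡#a+#b w)
length≡#a+#b (b ∷ w) = trans (cong suc (length≡#a+#b w)) (sym (+-suc (# a w) (# b w)))

∣#-#∣-infix : ∀ x u s t v → ∣ # x (u ++ s ++ v) - # x (u ++ t ++ v) ∣ ≡ ∣ # x s - # x t ∣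
∣#-#∣-infix x u s t v = begin
  ∣ # x (u ++ s ++ v) - # x (u ++ t ++ v) ∣
    ≡⟨ cong₂ ∣_-_∣ (#-++ x u (s ++ v)) (#-++ x u (t ++ v)) ⟩
  ∣ # x u ℕ.+ # x (s ++ v) - # x u ℕ.+ # x (t ++ v) ∣
    ≡⟨ ∣m+n-m+o∣≡∣n-o∣ (# x u) (# x (s ++ v)) (# x (t ++ v)) ⟩
  ∣ # x (s ++ v) - # x (t ++ v) ∣
    ≡⟨ cong₂ ∣_-_∣ (#-++ x s v) (#-++ x t v) ⟩
  ∣ # x s ℕ.+ # x v - # x t ℕ.+ # x v ∣
    ≡⟨ ∣m+o-n+o∣≡∣m-n∣ (# x s) (# x t) (# x v) ⟩
  ∣ # x s - # x t ∣ ∎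
  where open ≡-Reasoning

∣#-#∣-Edit : ∀ x {z w} → Edit z w → ∣ # x z - # x w ∣ ≤ 1
∣#-#∣-Edit x = λ
  { (substitution u y y′ v) → within-1 u (y ∷ []) (y′ ∷ []) v (#-letter≤1 x y) (#-letter≤1 x y′)
  ; (deletion u y v)        → within-1 u (y ∷ []) [] v (#-letter≤1 x y) z≤n
  ; (insertion u y v)       → within-1 u [] (y ∷ []) v z≤n (#-letter≤1 x y)
  }
  where
  within-1 : ∀ u s t v → # x s ≤ 1 → # x t ≤ 1 → ∣ # x (u ++ s ++ v) - # x (u ++ t ++ v) ∣ ≤ 1
  within-1 u s t v #s≤1 #t≤1 = begin
    ∣ # x (u ++ s ++ v) - # x (u ++ t ++ v) ∣   ≡⟨ ∣#-#∣-infix x u s t v ⟩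
    ∣ # x s - # x t ∣                           ≤⟨ ∣m-n∣≤m⊔n (# x s) (# x t) ⟩
    # x s ℕ.⊔ # x t                             ≤⟨ ⊔-lub #s≤1 #t≤1 ⟩
    1                                           ∎
    where open ≤-Reasoning

∣#-#∣-Edits : ∀ x {k z w} → Edits k z w → ∣ # x z - # x w ∣ ≤ k
∣#-#∣-Edits x {z = z} []           = ≤-reflexive (∣n-n∣≡0 (# x z))
∣#-#∣-Edits x {z = z} (_∷_ {w = y} {z′ = w} e es) =
  ≤-trans (∣-∣-triangle (# x z) (# x y) (# x w)) (+-mono-≤ (∣#-#∣-Edit x e) (∣#-#∣-Edits x es))

∣#-#∣≤levenshtein : ∀ x z w → ∣ # x z - # x w ∣ ≤ levenshtein z w
∣#-#∣≤levenshtein x z w = ∣#-#∣-Edits x (levenshtein-edits z w)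

-- The monoid B n

factorization⇒∼ : ∀ {n x} z → IsFactorization n x z → z ∼⟨ n ⟩ x
factorization⇒∼ {n} {x} z = subst (_∼⟨ n ⟩ x) (concat-map-[ z ])

∼⇒factorization : ∀ {n x} z → z ∼⟨ n ⟩ x → IsFactorization n x z
∼⇒factorization {n} {x} z = subst (_∼⟨ n ⟩ x) (sym (concat-map-[ z ]))

-- The universal property of B n, for homomorphisms to a monoid of endofunctions.
foldr-resp-∼ : ∀ {c} {A : Set c} {n} (_▷_ : Letter → A → A) →
  (∀ s → b ▷ (a ▷ s) ≡ foldr _▷_ s (replicate n b)) →
  ∀ {u v} → u ∼⟨ n ⟩ v → ∀ s → foldr _▷_ s u ≡ foldr _▷_ s v
foldr-resp-∼ _▷_ ba≡bⁿ ba∼bⁿ             s = ba≡bⁿ s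
foldr-resp-∼ _▷_ ba≡bⁿ ∼-refl            s = refl
foldr-resp-∼ _▷_ ba≡bⁿ (∼-sym v∼u)       s = sym (foldr-resp-∼ _▷_ ba≡bⁿ v∼u s)
foldr-resp-∼ _▷_ ba≡bⁿ (∼-trans u∼v v∼w) s =
  trans (foldr-resp-∼ _▷_ ba≡bⁿ u∼v s) (foldr-resp-∼ _▷_ ba≡bⁿ v∼w s)
foldr-resp-∼ _▷_ ba≡bⁿ (∼-cong {u = u} {u′} {v} {v′} u∼u′ v∼v′) s = begin
  foldr _▷_ s (u ++ v)             ≡⟨ foldr-++ _▷_ s u v ⟩
  foldr _▷_ (foldr _▷_ s v) u      ≡⟨ foldr-resp-∼ _▷_ ba≡bⁿ u∼u′ (foldr _▷_ s v) ⟩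
  foldr _▷_ (foldr _▷_ s v) u′     ≡⟨ cong (λ t → foldr _▷_ t u′) (foldr-resp-∼ _▷_ ba≡bⁿ v∼v′ s) ⟩
  foldr _▷_ (foldr _▷_ s v′) u′    ≡⟨ foldr-++ _▷_ s u′ v′ ⟨
  foldr _▷_ s (u′ ++ v′)           ∎
  where open ≡-Reasoning

halfFactorial-2 : HalfFactorial 2
halfFactorial-2 x =
    length x
  , (x , ∼⇒factorization x ∼-refl , refl)
  , λ { (z , fz , refl) → sym (length-resp-∼ (factorization⇒∼ z fz)) }
  where
  length-resp-∼ : ∀ {u v} → u ∼⟨ 2 ⟩ v → length u ≡ length v
  length-resp-∼ u∼v = foldr-resp-∼ (λ _ → suc) (λ _ → refl) u∼v 0

halfFactorial⇒n≡2 : ∀ {n} → HalfFactorial n → n ≡ 2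
halfFactorial⇒n≡2 {n} halfFactorial with halfFactorial (b ∷ a ∷ [])
... | _ , _ , unique = trans (sym (unique bⁿ-length)) (unique (b ∷ a ∷ [] , ∼-refl , refl))
  where
  bⁿ-length : L n (b ∷ a ∷ []) n
  bⁿ-length = replicate n b , ∼⇒factorization (replicate n b) (∼-sym ba∼bⁿ) , length-replicate n

lateAs : Word → ℕ
lateAs []      = 0
lateAs (a ∷ w) = lateAs w
lateAs (b ∷ w) = # a w

#a-normalForm : ∀ n k m → # a (normalForm n k m) ≡ k
#a-normalForm n zero    zero    = refl
#a-normalForm n zero    (suc m) = #a-normalForm n zero m
#a-normalForm n (suc k) m       = cong suc (#a-normalForm n k m)

lateAs-normalForm : ∀ n k m → lateAs (normalForm n k m) ≡ 0
lateAs-normalForm n zero    zero    = refl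
lateAs-normalForm n zero    (suc m) = #a-normalForm n zero m
lateAs-normalForm n (suc k) m       = lateAs-normalForm n k m

lateAs-aᵏb : ∀ k w → lateAs (replicate k a ++ b ∷ w) ≡ # a w
lateAs-aᵏb zero    w = refl
lateAs-aᵏb (suc k) w = lateAs-aᵏb k w

module _ (p : ℕ) where

  open import Data.Nat using (_+_; _*_)

  private
    n : ℕ
    n = suc p

  infixr 5 _▷_

  -- Left multiplication by a letter, with (k , m) standing for aᵏbᵐ.  Iterating ba = bⁿ gives
  -- baᵏ = b¹⁺ᵏᵖ.
  _▷_ : Letter → ℕ × ℕ → ℕ × ℕ
  a ▷ (k , m) = suc k , m
  b ▷ (k , m) = 0 , suc (k * p + m)

  exponents : Word → ℕ × ℕ
  exponents = foldr _▷_ (0 , 0)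

  a-exponent b-exponent : Word → ℕ
  a-exponent = proj₁ ∘ exponents
  b-exponent = proj₂ ∘ exponents

  normalize : Word → Word
  normalize = uncurry (normalForm n) ∘ exponents

  foldr-▷-replicate-b : ∀ j k m →
    foldr _▷_ (k , m) (replicate (suc j) b) ≡ (0 , suc j + (k * p + m))
  foldr-▷-replicate-b zero    k m = refl
  foldr-▷-replicate-b (suc j) k m = cong (b ▷_) (foldr-▷-replicate-b j k m)

  exponents-resp-∼ : ∀ {u v} → u ∼⟨ n ⟩ v → exponents u ≡ exponents v
  exponents-resp-∼ u∼v = foldr-resp-∼ _▷_ ba▷≡bⁿ▷ u∼v (0 , 0)
    where
    ba▷≡bⁿ▷ : ∀ s → b ▷ a ▷ s ≡ foldr _▷_ s (replicate n b)
    ba▷≡bⁿ▷ (k , m) = trans (cong (λ i → 0 , suc i) (+-assoc p (k * p) m))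
      (sym (foldr-▷-replicate-b p k m))

  exponents-normalForm : ∀ k m → exponents (normalForm n k m) ≡ (k , m)
  exponents-normalForm zero    zero    = refl
  exponents-normalForm zero    (suc m) = cong (b ▷_) (exponents-normalForm zero m)
  exponents-normalForm (suc k) m       = cong (a ▷_) (exponents-normalForm k m)

  exponents-aᵏb : ∀ k w →
    exponents (replicate k a ++ b ∷ w) ≡ (k , suc (a-exponent w * p + b-exponent w))
  exponents-aᵏb zero    w = refl
  exponents-aᵏb (suc k) w = cong (a ▷_) (exponents-aᵏb k w)

  infix 4 _⟶_ _⟶*_

  data _⟶_ : Word → Word → Set where
    ba⟶bⁿ : ∀ u v → u ++ b ∷ a ∷ v ⟶ u ++ replicate n b ++ v

  _⟶*_ : Word → Word → Set
  _⟶*_ = Star _⟶_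

  ∷-⟶ : ∀ x {z w} → z ⟶ w → x ∷ z ⟶ x ∷ w
  ∷-⟶ x (ba⟶bⁿ u v) = ba⟶bⁿ (x ∷ u) v

  ∷-⟶* : ∀ x {z w} → z ⟶* w → x ∷ z ⟶* x ∷ w
  ∷-⟶* x = gmap (x ∷_) (∷-⟶ x)

  ⟶⇒∼ : ∀ {z w} → z ⟶ w → z ∼⟨ n ⟩ w
  ⟶⇒∼ (ba⟶bⁿ u v) = ∼-cong (∼-refl {u = u}) (∼-cong ba∼bⁿ (∼-refl {u = v}))

  ⟶*⇒∼ : ∀ {z w} → z ⟶* w → z ∼⟨ n ⟩ w
  ⟶*⇒∼ = fold (_∼⟨ n ⟩_) (∼-trans ∘ ⟶⇒∼) ∼-refl

  bʲaᵏbᵐ-⟶* : ∀ j k m →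
    replicate (suc j) b ++ normalForm n k m ⟶* normalForm n 0 (suc j + (k * p + m))
  bʲaᵏbᵐ-⟶* (suc j) k       m = ∷-⟶* b (bʲaᵏbᵐ-⟶* j k m)
  bʲaᵏbᵐ-⟶* zero    zero    m = ε
  bʲaᵏbᵐ-⟶* zero    (suc k) m =
    ba⟶bⁿ [] (normalForm n k m)
      ◅ subst (λ i → replicate n b ++ normalForm n k m ⟶* normalForm n 0 (suc i))
          (sym (+-assoc p (k * p) m)) (bʲaᵏbᵐ-⟶* p k m)

  ⟶*-normalize : ∀ z → z ⟶* normalize z
  ⟶*-normalize []      = ε
  ⟶*-normalize (a ∷ z) = ∷-⟶* a (⟶*-normalize z)
  ⟶*-normalize (b ∷ z) =
    ∷-⟶* b (⟶*-normalize z) ◅◅ uncurry (bʲaᵏbᵐ-⟶* 0) (exponents z)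

  exponents-injective : ∀ z w → exponents z ≡ exponents w → z ∼⟨ n ⟩ w
  exponents-injective z w exps≡ = ∼-trans (⟶*⇒∼ (⟶*-normalize z))
    (subst (_∼⟨ n ⟩ w) (cong (uncurry (normalForm n)) (sym exps≡)) (∼-sym (⟶*⇒∼ (⟶*-normalize w))))

  factorization⇒exponents : ∀ {x} z → IsFactorization n x z → exponents z ≡ exponents x
  factorization⇒exponents z fz = exponents-resp-∼ (factorization⇒∼ z fz)

  exponents⇒factorization : ∀ {x} z → exponents z ≡ exponents x → IsFactorization n x z
  exponents⇒factorization {x} z exps≡ = ∼⇒factorization z (exponents-injective z x exps≡)

  factorization⇒normalize : ∀ {x} z → IsFactorization n x z → normalize z ≡ normalize x
  factorization⇒normalize z fz = cong (uncurry (normalForm n)) (factorization⇒exponents z fz)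

  #a≡a-exponent+lateAs : ∀ w → # a w ≡ a-exponent w + lateAs w
  #a≡a-exponent+lateAs []      = refl
  #a≡a-exponent+lateAs (a ∷ w) = cong suc (#a≡a-exponent+lateAs w)
  #a≡a-exponent+lateAs (b ∷ w) = refl

  b-exponent≡#b+lateAs*p : ∀ w → b-exponent w ≡ # b w + lateAs w * p
  b-exponent≡#b+lateAs*p []      = refl
  b-exponent≡#b+lateAs*p (a ∷ w) = b-exponent≡#b+lateAs*p w
  b-exponent≡#b+lateAs*p (b ∷ w) = cong suc (begin
    k * p + b-exponent w              ≡⟨ cong (k * p +_) (b-exponent≡#b+lateAs*p w) ⟩
    k * p + (# b w + lateAs w * p)    ≡⟨ collect k (lateAs w) (# b w) p ⟩
    # b w + (k + lateAs w) * p        ≡⟨ cong (λ i → # b w + i * p) (#a≡a-exponent+lateAs w) ⟨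
    # b w + # a w * p                 ∎)
    where
    open ≡-Reasoning
    k : ℕ
    k = a-exponent w
    collect : ∀ k α β p → k * p + (β + α * p) ≡ β + (k + α) * p
    collect = solve-∀

  IsLateCount : ℕ → ℕ → Set
  IsLateCount m α = α ≡ 0 ⊎ α * p < m

  lateAs-isLateCount : ∀ w → IsLateCount (b-exponent w) (lateAs w)
  lateAs-isLateCount []      = inj₁ refl
  lateAs-isLateCount (a ∷ w) = lateAs-isLateCount w
  lateAs-isLateCount (b ∷ w) =
    inj₂ (subst (# a w * p <_) (sym (b-exponent≡#b+lateAs*p (b ∷ w)))
      (s≤s (m≤n+m (# a w * p) (# b w))))

  lateCount-realized : ∀ k {m α} → IsLateCount m α → ∃ λ z → exponents z ≡ (k , m) × lateAs z ≡ α
  lateCount-realized k {m}         (inj₁ refl) =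
    normalForm n k m , exponents-normalForm k m , lateAs-normalForm n k m
  lateCount-realized k {suc m} {α} (inj₂ (s≤s αp≤m)) =
      replicate k a ++ b ∷ w
    , (begin
        exponents (replicate k a ++ b ∷ w)
          ≡⟨ exponents-aᵏb k w ⟩
        (k , suc (a-exponent w * p + b-exponent w))
          ≡⟨ cong (λ (i , j) → k , suc (i * p + j)) w-exponents ⟩
        (k , suc (α * p + (m ∸ α * p)))
          ≡⟨ cong (λ i → k , suc i) (m+[n∸m]≡n αp≤m) ⟩
        (k , suc m) ∎)
    , trans (lateAs-aᵏb k w) (#a-normalForm n α (m ∸ α * p))
    where
    open ≡-Reasoning
    w : Word
    w = normalForm n α (m ∸ α * p)
    w-exponents : exponents w ≡ (α , m ∸ α * p)
    w-exponents = exponents-normalForm α (m ∸ α * p)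

  lateAs≡0⇒normal : ∀ z → lateAs z ≡ 0 → z ≡ normalize z
  lateAs≡0⇒normal []      _      = refl
  lateAs≡0⇒normal (a ∷ z) late≡0 = cong (a ∷_) (lateAs≡0⇒normal z late≡0)
  lateAs≡0⇒normal (b ∷ z) #a≡0   = cong (b ∷_) (begin
    z                             ≡⟨ lateAs≡0⇒normal z (m+n≡0⇒n≡0 k k+late≡0) ⟩
    normalForm n k m              ≡⟨ absorb-a⁰ (m+n≡0⇒m≡0 k k+late≡0) ⟩
    normalForm n 0 (k * p + m)    ∎)
    where
    open ≡-Reasoning
    k m : ℕ
    k = a-exponent z
    m = b-exponent z
    k+late≡0 : k + lateAs z ≡ 0
    k+late≡0 = trans (sym (#a≡a-exponent+lateAs z)) #a≡0
    absorb-a⁰ : ∀ {k} → k ≡ 0 → normalForm n k m ≡ normalForm n 0 (k * p + m)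
    absorb-a⁰ refl = refl

  module _ .{{_ : NonZero p}} where

    -- The catenary degree

    ⟶⇒Edits : ∀ {z w} → z ⟶ w → Edits p z w
    ⟶⇒Edits (ba⟶bⁿ u v) = Edits-++ˡ u (Edits-cons b (Edits-letter-to-power p a b v))

    ⟶*⇒Links : ∀ {x z w} → IsFactorization n x z → z ⟶* w → Star (Link n levenshtein x (fin p)) z w
    ⟶*⇒Links         fz ε                      = ε
    ⟶*⇒Links {x} {z} fz (_◅_ {j = y} z⟶y y⟶*w) =
      (fz , fy , [ levenshtein-≤ (⟶⇒Edits z⟶y) ]) ◅ ⟶*⇒Links fy y⟶*w
      where
      fy : IsFactorization n x y
      fy = ∼⇒factorization y (∼-trans (∼-sym (⟶⇒∼ z⟶y)) (factorization⇒∼ z fz))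

    chainConnected-p : ∀ x → ChainConnected n levenshtein x (fin p)
    chainConnected-p x z w fz fw =
      to-normal z fz ◅◅ reverse (λ {y} {y′} → Link-sym y y′) (to-normal w fw)
      where
      to-normal : ∀ y → IsFactorization n x y → Star (Link n levenshtein x (fin p)) y (normalize x)
      to-normal y fy =
        subst (Star _ y) (factorization⇒normalize y fy) (⟶*⇒Links fy (⟶*-normalize y))

    Link-preserves-lateAs : ∀ {x j} z w → j < p →
      Link n levenshtein x (fin j) z w → lateAs z ≡ lateAs w
    Link-preserves-lateAs {j = j} z w j<p (fz , fw , d≤j) =
      ∣m-n∣≡0⇒m≡n (m*n<n⇒m≡0 ∣ lateAs z - lateAs w ∣ p (begin-strict
        ∣ lateAs z - lateAs w ∣ * p          ≡⟨ *-distribʳ-∣-∣ p (lateAs z) (lateAs w) ⟩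
        ∣ lateAs z * p - lateAs w * p ∣      ≡⟨ m+n≡o+i⇒∣m-o∣≡∣n-i∣ (# b z) (# b w) sums≡ ⟨
        ∣ # b z - # b w ∣                    ≤⟨ ∣#-#∣≤levenshtein b z w ⟩
        levenshtein z w                      ≤⟨ [≤]-injective d≤j ⟩
        j                                    <⟨ j<p ⟩
        p                                    ∎))
      where
      open ≤-Reasoning
      exps≡ : exponents z ≡ exponents w
      exps≡ = trans (factorization⇒exponents z fz) (sym (factorization⇒exponents w fw))
      sums≡ : # b z + lateAs z * p ≡ # b w + lateAs w * p
      sums≡ = trans (sym (b-exponent≡#b+lateAs*p z))
        (trans (cong proj₂ exps≡) (b-exponent≡#b+lateAs*p w))

    chainConnected⇒lateCount-unique : ∀ {x j α α′} →
      j < p → ChainConnected n levenshtein x (fin j) →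
      IsLateCount (b-exponent x) α → IsLateCount (b-exponent x) α′ → α ≡ α′
    chainConnected⇒lateCount-unique {x} j<p connected α-late α′-late
      with lateCount-realized (a-exponent x) α-late | lateCount-realized (a-exponent x) α′-late
    ... | z , z-exps , refl | w , w-exps , refl =
      fold (λ y y′ → lateAs y ≡ lateAs y′)
        (λ {y} {y′} link → trans (Link-preserves-lateAs y y′ j<p link)) refl
        (connected z w (exponents⇒factorization z z-exps) (exponents⇒factorization w w-exps))

    chainConnected⇒p≤ : ∀ {x} N → p < b-exponent x → ChainConnected n levenshtein x N → fin p ≤∞ N
    chainConnected⇒p≤     ⊤⁺     p<m connected = fin p ≤⊤⁺
    chainConnected⇒p≤ {x} [ j ]⁺ p<m connected = [ ≮⇒≥ (λ j<p →
      0≢1+n {0} (chainConnected⇒lateCount-unique j<p connected (inj₁ refl) (inj₂ 1*p<m))) ]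
      where
      1*p<m : 1 * p < b-exponent x
      1*p<m = subst (_< b-exponent x) (sym (*-identityˡ p)) p<m

    catenaryDegreeAt-p : ∀ {x} → p < b-exponent x → IsCatenaryDegreeAt n levenshtein x (fin p)
    catenaryDegreeAt-p {x} p<m = chainConnected-p x , λ N → chainConnected⇒p≤ N p<m

    factorization-unique : ∀ {x} z → b-exponent x ≤ p → IsFactorization n x z → z ≡ normalize x
    factorization-unique {x} z m≤p fz = trans
      (lateAs≡0⇒normal z (late≡0 (lateAs-isLateCount z))) (factorization⇒normalize z fz)
      where
      open ≤-Reasoning
      late≡0 : IsLateCount (b-exponent z) (lateAs z) → lateAs z ≡ 0
      late≡0 (inj₁ α≡0)  = α≡0
      late≡0 (inj₂ αp<m) = m*n<n⇒m≡0 (lateAs z) p (begin-strict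
        lateAs z * p    <⟨ αp<m ⟩
        b-exponent z    ≡⟨ cong proj₂ (factorization⇒exponents z fz) ⟩
        b-exponent x    ≤⟨ m≤p ⟩
        p               ∎)

    catenaryDegreeAt-0 : ∀ {x} → b-exponent x ≤ p → IsCatenaryDegreeAt n levenshtein x (fin 0)
    catenaryDegreeAt-0 {x} m≤p = connected , 0≤∞
      where
      connected : ChainConnected n levenshtein x (fin 0)
      connected z w fz fw =
        subst (Star _ z)
          (trans (factorization-unique z m≤p fz) (sym (factorization-unique w m≤p fw))) ε
      0≤∞ : ∀ N → ChainConnected n levenshtein x N → fin 0 ≤∞ N
      0≤∞ ⊤⁺     _ = fin 0 ≤⊤⁺
      0≤∞ [ j ]⁺ _ = [ z≤n ]

    catenaryDegreeAt-≤p : ∀ x → ∃ λ N → IsCatenaryDegreeAt n levenshtein x N × N ≤∞ fin p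
    catenaryDegreeAt-≤p x with p <? b-exponent x
    ... | yes p<m = fin p , catenaryDegreeAt-p p<m , [ ≤-refl ]
    ... | no  p≮m = fin 0 , catenaryDegreeAt-0 (≮⇒≥ p≮m) , [ z≤n ]

    catenaryDegree-p : IsCatenaryDegree n levenshtein (fin p)
    catenaryDegree-p = degree , isDegree , (proj₂ ∘ proj₂ ∘ catenaryDegreeAt-≤p) , λ u degree≤u →
      ≤⁺-trans ≤-trans (chainConnected⇒p≤ (degree bⁿ) p<m (proj₁ (isDegree bⁿ))) (degree≤u bⁿ)
      where
      degree : Word → ℕ∞
      degree = proj₁ ∘ catenaryDegreeAt-≤p
      isDegree : ∀ x → IsCatenaryDegreeAt n levenshtein x (degree x)
      isDegree = proj₁ ∘ proj₂ ∘ catenaryDegreeAt-≤p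
      bⁿ : Word
      bⁿ = normalForm n 0 n
      p<m : p < b-exponent bⁿ
      p<m = subst (p <_) (sym (cong proj₂ (exponents-normalForm 0 n))) ≤-refl

    -- Sets of lengths

    length+lateAs*pred[p] : ∀ z → length z + lateAs z * pred p ≡ a-exponent z + b-exponent z
    length+lateAs*pred[p] z = begin
      length z + α * pred p           ≡⟨ cong (_+ α * pred p) (length≡#a+#b z) ⟩
      # a z + β + α * pred p          ≡⟨ cong (λ i → i + β + α * pred p) (#a≡a-exponent+lateAs z) ⟩
      k + α + β + α * pred p          ≡⟨ collect k α β (pred p) ⟩
      k + (β + α * suc (pred p))      ≡⟨ cong (λ i → k + (β + α * i)) (suc-pred p) ⟩
      k + (β + α * p)                 ≡⟨ cong (k +_) (b-exponent≡#b+lateAs*p z) ⟨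
      k + b-exponent z                ∎
      where
      open ≡-Reasoning
      k α β : ℕ
      k = a-exponent z
      α = lateAs z
      β = # b z
      collect : ∀ k α β r → k + α + β + α * r ≡ k + (β + α * suc r)
      collect = solve-∀

    length⇒lateCount : ∀ {k m l} → L n (normalForm n k m) l →
      ∃ λ α → IsLateCount m α × l + α * pred p ≡ k + m
    length⇒lateCount {k} {m} (z , fz , refl) =
        lateAs z
      , subst (λ s → IsLateCount (proj₂ s) (lateAs z)) exps≡ (lateAs-isLateCount z)
      , trans (length+lateAs*pred[p] z) (cong (uncurry _+_) exps≡)
      where
      exps≡ : exponents z ≡ (k , m)
      exps≡ = trans (factorization⇒exponents z fz) (exponents-normalForm k m)

    lateCount⇒length : ∀ {k m α} → IsLateCount m α →
      ∃ λ l → L n (normalForm n k m) l × l + α * pred p ≡ k + m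
    lateCount⇒length {k} {m} α-late with lateCount-realized k α-late
    ... | z , exps≡ , refl =
        length z
      , (z , exponents⇒factorization z (trans exps≡ (sym (exponents-normalForm k m))) , refl)
      , trans (length+lateAs*pred[p] z) (cong (uncurry _+_) exps≡)

lateCount⇒≤q : ∀ {n} m {α} (2≤n : 2 ≤ n) → IsLateCount (n ∸ 1) m α → α ≤ q m n 2≤n
lateCount⇒≤q                 m             2≤n             (inj₁ refl) = z≤n
lateCount⇒≤q {suc p@(suc _)} m@(suc _) {α} (s≤s (s≤s _)) (inj₂ αp<m) with p ∣? m
... | yes p∣m = <⇒≤pred (*-cancelʳ-< p α (m ℕ./ p) (subst (α ℕ.* p <_) (sym (m/n*n≡m p∣m)) αp<m))
... | no  _   = subst (_≤ m ℕ./ p) (m*n/n≡m α p) (/-monoˡ-≤ p (<⇒≤ αp<m))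

≤q⇒lateCount : ∀ {n} m {α} (2≤n : 2 ≤ n) → α ≤ q m n 2≤n → IsLateCount (n ∸ 1) m α
≤q⇒lateCount                 m         {zero}  _             _   = inj₁ refl
≤q⇒lateCount {suc p@(suc _)} m@(suc _) {suc α} (s≤s (s≤s _)) α<q with p ∣? m
... | yes p∣m = inj₂ (subst (suc α ℕ.* p <_) (m/n*n≡m p∣m)
  (*-monoˡ-< p (pred-cancel-< {n = m ℕ./ p} α<q)))
... | no  p∤m = inj₂ (≤∧≢⇒< (≤-trans (*-monoˡ-≤ p α<q) (m/n*n≤m m p))
  λ αp≡m → p∤m (divides (suc α) (sym αp≡m)))

open import Data.Integer using (+_; _+_; _-_; _*_; +≤+)
open import Data.Integer.Properties using (pos-*)
import Data.Integer.Tactic.RingSolver as ℤ-Solver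

asℤ-arithmeticProgression : ∀ {P : Pred ℕ 0ℓ} s d Q →
  (∀ {l} → P l → ∃ λ α → α ≤ Q × l ℕ.+ α ℕ.* d ≡ s) →
  (∀ {α} → α ≤ Q → ∃ λ l → P l × l ℕ.+ α ℕ.* d ≡ s) →
  asℤ P ≐ (+ s - + Q * + d) +ˢ + d ·ˢ [ + 0 ⋯ + Q ]
asℤ-arithmeticProgression {P} s d Q P⇒α α⇒P = ⊆ , ⊇
  where
  term-identity : ∀ {l α i} → l ℕ.+ α ℕ.* d ≡ s → α ℕ.+ i ≡ Q → + l ≡ (+ s - + Q * + d) + + d * + i
  term-identity {l} {α} {i} refl refl = trans (expand (+ l) (+ α) (+ i) (+ d))
    (cong (λ t → (+ l + t) - + (α ℕ.+ i) * + d + + d * + i) (sym (pos-* α d)))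
    where
    expand : ∀ l α i d → l ≡ (l + α * d) - (α + i) * d + d * i
    expand = ℤ-Solver.solve-∀
  ⊆ : ∀ {z} → asℤ P z → ((+ s - + Q * + d) +ˢ + d ·ˢ [ + 0 ⋯ + Q ]) z
  ⊆ (l , l∈P , refl) with P⇒α l∈P
  ... | α , α≤Q , l+αd≡s =
      + d * + (Q ∸ α)
    , (+ (Q ∸ α) , (+≤+ z≤n , +≤+ (m∸n≤m Q α)) , refl)
    , term-identity l+αd≡s (m+[n∸m]≡n α≤Q)
  ⊇ : ∀ {z} → ((+ s - + Q * + d) +ˢ + d ·ˢ [ + 0 ⋯ + Q ]) z → asℤ P z
  ⊇ (_ , (_ , (+≤+ {n = i} _ , +≤+ i≤Q) , refl) , refl) with α⇒P (m∸n≤m Q i)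
  ... | l , l∈P , l+αd≡s = l , l∈P , sym (term-identity l+αd≡s (m∸n+n≡m i≤Q))

theorem4p1 : (n : ℕ) (2≤n : 2 ≤ n) →
    (IsCatenaryDegree n levenshtein (fin (n ∸ 1)) × (HalfFactorial n ⇔ n ≡ 2))
    × (∀ (k m : ℕ) →
        asℤ (L n (normalForm n k m))
          ≐ ((+ k + + m) - + q m n 2≤n * (+ n - + 2))
              +ˢ (+ n - + 2) ·ˢ [ + 0 ⋯ + q m n 2≤n ])
theorem4p1 (suc p@(suc r)) 2≤n@(s≤s (s≤s _)) =
    (catenaryDegree-p p , mk⇔ halfFactorial⇒n≡2 λ { refl → halfFactorial-2 })
  , λ k m → asℤ-arithmeticProgression (k ℕ.+ m) r (q m (suc p) 2≤n)
      (map₂ (map₁ (lateCount⇒≤q m 2≤n)) ∘ length⇒lateCount p)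
      (lateCount⇒length p ∘ ≤q⇒lateCount m 2≤n)
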